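{- Let $G$ be a connected undirected graph on $N\ge 2$ nodes with positive link weights, and let $\mathcal{S}$ and $\mathcal{S}^{+}$ be its original and inverse simplices in $\mathbb{R}^{N-1}$. Let $\mathcal{V}_1,\mathcal{V}_2$ be non-empty proper subsets of $\mathcal{N}=\{1,\dots,N\}$ with $V_1$ and $V_2$ elements respectively. Then the centroid vectors $c_{\mathcal{V}_1},c_{\mathcal{V}_2}$ of the corresponding faces of $\mathcal{S}$ satisfy $$c_{\mathcal{V}_1}^Tc_{\mathcal{V}_2}=-\frac{\vert\partial\mathcal{V}_1\cap\partial\mathcal{V}_2\vert}{V_1V_2},$$ and the altitudes $a^{+}_{\mathcal{V}_1},a^{+}_{\mathcal{V}_2}$ of the inverse simplex $\mathcal{S}^{+}$ determined by $\mathcal{V}_1$ and $\mathcal{V}_2$ satisfy $$a^{+T}_{\mathcal{V}_1}a^{+}_{\mathcal{V}_2}=-\frac{\vert\partial\mathcal{V}_1\cap\partial\mathcal{V}_2\vert}{\vert\partial\mathcal{V}_1\vert\,\vert\partial\mathcal{V}_2\vert},$$ where $$\partial\mathcal{V}_1\cap\partial\mathcal{V}_2=\{(i,j)\in\mathcal{L} \mid i\in\mathcal{V}_1\text{ and }j\in\mathcal{V}_2\}.$$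
   Context: The graph $G$ has node set $\mathcal{N}=\{1,\dots,N\}$, link set $\mathcal{L}$ (links join distinct nodes) and weights $w_{ij}=w_{ji}>0$ for $(i,j)\in\mathcal{L}$ (all equal to $1$ in the unweighted case). The Laplacian $Q$ is the $N\times N$ symmetric matrix with $(Q)_{ii}=d_i$, the sum of the weights of links incident to $i$, $(Q)_{ij}=-w_{ij}$ if $(i,j)\in\mathcal{L}$, and $(Q)_{ij}=0$ otherwise. Since $G$ is connected, $Q$ has eigenvalues $\mu_1\ge\dots\ge\mu_{N-1}>\mu_N=0$ with orthonormal eigenvectors $z_1,\dots,z_N$; fix such an eigenbasis. The original simplex $\mathcal{S}$ of $G$ is the convex hull of the vertices $s_1,\dots,s_N\in\mathbb{R}^{N-1}$ with $(s_i)_k=(z_k)_i\sqrt{\mu_k}$, and the inverse simplex $\mathcal{S}^{+}$ is the convex hull of the vertices $s^{+}_1,\dots,s^{+}_N\in\mathbb{R}^{N-1}$ with $(s^{+}_i)_k=(z_k)_i/\sqrt{\mu_k}$, $k=1,\dots,N-1$. For $\emptyset\ne\mathcal{V}\subsetneq\mathcal{N}$ with $V$ elements, write $\bar{\mathcal{V}}=\mathcal{N}\setminus\mathcal{V}$. The centroid vector of the face of $\mathcal{S}$ with vertices $\{s_i\}_{i\in\mathcal{V}}$ is $c_{\mathcal{V}}=\frac1V\sum_{i\in\mathcal{V}}s_i$. The face $\mathcal{F}^{+}_{\mathcal{V}}$ of $\mathcal{S}^{+}$ is the convex hull of $\{s^{+}_i\}_{i\in\mathcal{V}}$. The altitude $a^{+}_{\mathcal{V}}$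 of $\mathcal{S}^{+}$ is the vector $a^{+}_{\mathcal{V}}=p^{\star}-q^{\star}$ with $p^{\star}\in\mathcal{F}^{+}_{\bar{\mathcal{V}}}$ and $q^{\star}\in\mathcal{F}^{+}_{\mathcal{V}}$ which is orthogonal to both faces, i.e. orthogonal to $p-p'$ for all $p,p'\in\mathcal{F}^{+}_{\mathcal{V}}$ and for all $p,p'\in\mathcal{F}^{+}_{\bar{\mathcal{V}}}$. The cut set $\partial\mathcal{V}$ is the set of links $(i,j)\in\mathcal{L}$ with $i\in\mathcal{V}$ and $j\in\bar{\mathcal{V}}$. For a set of links, $\vert\cdot\vert$ denotes the number of its links (or, for weighted graphs, the sum of their weights).
   Formalization: The formal theorem additionally assumes that V_1 and V_2 are disjoint; without this the claim is false (for V_1=V_2 the left side is positive and the right side is not), and the stated description of the intersection of the cut sets holds only for disjoint sets. -}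

module Defs where

open import Algebra.Apartness.Bundles using (HeytingField)
open import Algebra.Bundles using (Ring; Semiring)
import Algebra.Apartness.Properties.HeytingCommutativeRing as HCRProperties
import Algebra.Definitions.RawMonoid as RawMonoidDefs
import Algebra.Properties.Ring as RingProperties
import Algebra.Properties.Semiring.Sum as SemiringSum
open import Data.Bool.Base using (if_then_else_)
open import Data.Empty using (⊥-elim)
open import Data.Fin.Base as Fin using (Fin; zero; suc; fromℕ; inject₁)
open import Data.Fin.Properties as Finₚ using (_≟_; _<?_)
open import Data.Fin.Subset
  using (Subset; _∈_; _∉_; _⊂_; ⊤; ∁; ∣_∣; Nonempty)
open import Data.Fin.Subset.Properties using (_∈?_; x∉p⇒x∈∁p; x∈p⇒∣p-x∣<∣p∣)
open import Data.Nat.Base as ℕ using (ℕ; zero; suc)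
open import Data.Product.Base using (_×_; _,_; proj₁; proj₂; ∃)
open import Data.Sum.Base using (_⊎_; inj₁; inj₂)
open import Data.Vec.Functional using (Vector)
open import Level using (Level; 0ℓ; _⊔_) renaming (suc to lsuc)
open import Relation.Binary.Construct.Closure.ReflexiveTransitive
  using (Star; ε; _◅_)
open import Relation.Binary.Core using (Rel)
open import Relation.Binary.Definitions
  using (Decidable; Symmetric; tri<; tri≈; tri>)
open import Relation.Binary.PropositionalEquality.Core as ≡ using (_≡_)
open import Relation.Binary.Structures using (IsStrictPartialOrder)
open import Relation.Nullary.Decidable.Core
  using (Dec; yes; no; does; _×-dec_; _⊎-dec_)
open import Relation.Nullary.Negation.Core using (¬_)
import Relation.Unary as U

-- The order axioms are the constructive ones: there is no trichotomy, and the
-- non-strict order is the negation of the converse strict order.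
record OrderedField c ℓ₁ ℓ₂ : Set (lsuc (c ⊔ ℓ₁ ⊔ ℓ₂)) where
  infix 4 _<_ _≤_

  field
    heytingField : HeytingField c ℓ₁ ℓ₂

  open HeytingField heytingField public

  field
    _<_                  : Rel Carrier ℓ₂
    isStrictPartialOrder : IsStrictPartialOrder _≈_ _<_
    <⇒#                  : ∀ {x y} → x < y → x # y
    #⇒<⊎>                : ∀ {x y} → x # y → x < y ⊎ y < x
    +-monoˡ-<            : ∀ z {x y} → x < y → x + z < y + z
    *-pos                : ∀ {x y} → 0# < x → 0# < y → 0# < x * y

  _≤_ : Rel Carrier ℓ₂
  x ≤ y = ¬ (y < x)

  ring : Ring c ℓ₁
  ring = record { isRing = isRing }

  semiring : Semiring c ℓ₁
  semiring = record { isSemiring = isSemiring }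

  open RawMonoidDefs (Semiring.+-rawMonoid semiring)
    using () renaming (_×_ to _·_)

  fromNat : ℕ → Carrier
  fromNat n = n · 1#

  IsCauchy : (ℕ → Carrier) → Set (c ⊔ ℓ₂)
  IsCauchy u = ∀ e → 0# < e →
    ∃ λ K → ∀ m n → K ℕ.≤ m → K ℕ.≤ n → u m < u n + e

  _ConvergesTo_ : (ℕ → Carrier) → Carrier → Set (c ⊔ ℓ₂)
  u ConvergesTo l = ∀ e → 0# < e →
    ∃ λ K → ∀ n → K ℕ.≤ n → (u n < l + e) × (l < u n + e)

-- The field of real numbers: an Archimedean, Cauchy-complete ordered field.
-- Classically this determines ℝ up to isomorphism.  The square root is
-- determined by its two laws; it is an operation of the structure only to save
-- its construction from completeness.
record Reals c ℓ₁ ℓ₂ : Set (lsuc (c ⊔ ℓ₁ ⊔ ℓ₂)) where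
  field
    orderedField : OrderedField c ℓ₁ ℓ₂

  open OrderedField orderedField public

  field
    archimedean : ∀ x → ∃ λ n → x < fromNat n
    complete    : ∀ u → IsCauchy u → ∃ λ l → u ConvergesTo l
    √           : ∀ x → 0# ≤ x → Carrier
    √-nonneg    : ∀ x (p : 0# ≤ x) → 0# ≤ √ x p
    √-square    : ∀ x (p : 0# ≤ x) → √ x p * √ x p ≈ x

module RealProperties {c ℓ₁ ℓ₂} (ℝ : Reals c ℓ₁ ℓ₂) where
  open Reals ℝ hiding (zero)
  open HCRProperties (HeytingField.heytingCommutativeRing heytingField)
    using (x-0≈x; 1#0; invertibleˡ⇒#)
  open SemiringSum semiring using (sum)
  open RingProperties ring
    using (-‿involutive; -1*x≈-x)
  open IsStrictPartialOrder isStrictPartialOrder public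
    using (<-respʳ-≈; <-respˡ-≈)
    renaming (irrefl to <-irrefl; trans to <-trans)

  <⇒≤ : ∀ {x y} → x < y → x ≤ y
  <⇒≤ p q = <-irrefl refl (<-trans p q)

  infix 9 _⁻¹[_]
  _⁻¹[_] : ∀ x → 0# < x → Carrier
  x ⁻¹[ p ] = proj₁ (#⇒invertible (#-sym (<⇒# p)))

  infixl 7 _/_[_]
  _/_[_] : Carrier → ∀ y → 0# < y → Carrier
  x / y [ p ] = x * y ⁻¹[ p ]

  ⁻¹-inverseˡ : ∀ x (p : 0# < x) → x ⁻¹[ p ] * x ≈ 1#
  ⁻¹-inverseˡ x p = trans (*-congˡ (sym (x-0≈x x)))
    (proj₁ (proj₂ (#⇒invertible (#-sym (<⇒# p)))))

  0<1 : 0# < 1#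
  0<1 with #⇒<⊎> 1#0
  ... | inj₂ p = p
  ... | inj₁ p = ⊥-elim (<-irrefl refl (<-trans p 0<1′))
    where
    0<-1 : 0# < - 1#
    0<-1 = <-respˡ-≈ (-‿inverseʳ 1#)
             (<-respʳ-≈ (+-identityˡ (- 1#)) (+-monoˡ-< (- 1#) p))
    0<1′ : 0# < 1#
    0<1′ = <-respʳ-≈ (trans (-1*x≈-x (- 1#)) (-‿involutive 1#))
             (*-pos 0<-1 0<-1)

  +-pos : ∀ {x y} → 0# < x → 0# < y → 0# < x + y
  +-pos {x} {y} p q =
    <-trans q (<-respˡ-≈ (+-identityˡ y) (+-monoˡ-< y p))

  √-pos : ∀ x (p : 0# < x) → 0# < √ x (<⇒≤ p)
  √-pos x p with #⇒<⊎> √#0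
    where
    r : Carrier
    r = √ x (<⇒≤ p)
    √#0 : r # 0#
    √#0 = invertibleˡ⇒# (x ⁻¹[ p ] * r ,
      trans (*-congˡ (x-0≈x r))
        (trans (*-assoc _ _ _)
          (trans (*-congˡ (√-square x (<⇒≤ p))) (⁻¹-inverseˡ x p))))
  ... | inj₁ q = ⊥-elim (√-nonneg x (<⇒≤ p) q)
  ... | inj₂ q = q

  fromNat-pos : ∀ n → 0 ℕ.< n → 0# < fromNat n
  fromNat-pos (suc zero)    _ = <-respʳ-≈ (sym (+-identityʳ 1#)) 0<1
  fromNat-pos (suc (suc n)) _ = +-pos 0<1 (fromNat-pos (suc n) (ℕ.s≤s ℕ.z≤n))

  ZeroOrPos : Carrier → Set _
  ZeroOrPos x = x ≈ 0# ⊎ 0# < x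

  sum-zeroOrPos : ∀ {n} (x : Vector Carrier n) →
                  (∀ i → ZeroOrPos (x i)) → ZeroOrPos (sum x)
  sum-zeroOrPos {zero}  x h = inj₁ refl
  sum-zeroOrPos {suc n} x h
    with h zero | sum-zeroOrPos (λ i → x (suc i)) (λ i → h (suc i))
  ... | inj₁ p | inj₁ q = inj₁ (trans (+-cong p q) (+-identityˡ 0#))
  ... | inj₁ p | inj₂ q =
    inj₂ (<-respʳ-≈ (sym (trans (+-congʳ p) (+-identityˡ _))) q)
  ... | inj₂ p | inj₁ q =
    inj₂ (<-respʳ-≈ (sym (trans (+-congˡ q) (+-identityʳ _))) p)
  ... | inj₂ p | inj₂ q = inj₂ (+-pos p q)

  sum-pos : ∀ {n} (x : Vector Carrier n) → (∀ i → ZeroOrPos (x i)) →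
            ∀ i → 0# < x i → 0# < sum x
  sum-pos x h zero    p with sum-zeroOrPos (λ i → x (suc i)) (λ i → h (suc i))
  ... | inj₁ q = <-respʳ-≈ (sym (trans (+-congˡ q) (+-identityʳ _))) p
  ... | inj₂ q = +-pos p q
  sum-pos x h (suc i) p
    with h zero | sum-pos (λ i → x (suc i)) (λ i → h (suc i)) i p
  ... | inj₁ q | r = <-respʳ-≈ (sym (trans (+-congʳ q) (+-identityˡ _))) r
  ... | inj₂ q | r = +-pos q r

module GraphGeometry {c ℓ₁ ℓ₂} (ℝ : Reals c ℓ₁ ℓ₂) where
  open Reals ℝ public hiding (zero)
  open RealProperties ℝ public
  open SemiringSum semiring public using (sum)

  -- The weight w i j is meaningful only when (i , j) is a link; its value
  -- elsewhere is never used.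
  record WeightedGraph (N : ℕ) : Set (c ⊔ ℓ₁ ⊔ ℓ₂ ⊔ lsuc 0ℓ) where
    field
      Link        : Rel (Fin N) 0ℓ
      link?       : Decidable Link
      link-sym    : Symmetric Link
      link-irrefl : ∀ {i} → ¬ Link i i
      w           : Fin N → Fin N → Carrier
      w-sym       : ∀ {i j} → Link i j → w i j ≈ w j i
      w-pos       : ∀ {i j} → Link i j → 0# < w i j

  Connected : ∀ {N} → WeightedGraph N → Set
  Connected G = ∀ i j → Star (WeightedGraph.Link G) i j

  -- Links are undirected, so a set of links is a symmetric predicate on
  -- ordered pairs of nodes, (i , j) and (j , i) naming the same link.
  module Links {N} (G : WeightedGraph N) where
    open WeightedGraph G

    LinkSet : Set₁
    LinkSet = U.Pred (Fin N × Fin N) 0ℓ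

    between : Subset N → Subset N → LinkSet
    between A B (i , j) = Link i j × ((i ∈ A × j ∈ B) ⊎ (j ∈ A × i ∈ B))

    between? : ∀ A B → U.Decidable (between A B)
    between? A B (i , j) = link? i j ×-dec
      (((i ∈? A) ×-dec (j ∈? B)) ⊎-dec ((j ∈? A) ×-dec (i ∈? B)))

    ∂ : Subset N → LinkSet
    ∂ V = between V (∁ V)

    ∂? : ∀ V → U.Decidable (∂ V)
    ∂? V = between? V (∁ V)

    -- The condition i < j makes each undirected link count exactly once.
    weight : {P : LinkSet} → U.Decidable P → Carrier
    weight P? = sum λ i → sum λ j →
      if does ((i <? j) ×-dec P? (i , j)) then w i j else 0#

    degree : Fin N → Carrier
    degree i = sum λ j → if does (link? i j) then w i j else 0#

    laplacian : Fin N → Fin N → Carrier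
    laplacian i j =
      if does (i ≟ j) then degree i
      else if does (link? i j) then - w i j
      else 0#

  open Links public

  inner : ∀ {m} → Vector Carrier m → Vector Carrier m → Carrier
  inner x y = sum λ k → x k * y k

  infixl 6 _⊖_
  _⊖_ : ∀ {m} → Vector Carrier m → Vector Carrier m → Vector Carrier m
  (x ⊖ y) k = x k - y k

  -- The graph has N = suc n nodes.  The eigenvalues μ₁ ≥ … ≥ μ_{N-1} are
  -- indexed by inject₁ k with k : Fin n, and μ_N is indexed by fromℕ n.
  record Eigenbasis {n} (G : WeightedGraph (suc n)) :
         Set (c ⊔ ℓ₁ ⊔ ℓ₂) where
    field
      μ           : Fin (suc n) → Carrier
      z           : Fin (suc n) → Vector Carrier (suc n)
      eigen       : ∀ k i → sum (λ j → laplacian G i j * z k j) ≈ μ k * z k i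
      orthonormal : ∀ k l →
                    inner (z k) (z l) ≈ (if does (k ≟ l) then 1# else 0#)
      μ-sorted    : ∀ {k l} → k Fin.≤ l → μ l ≤ μ k
      μ-pos       : ∀ k → 0# < μ (inject₁ k)
      μ-last      : μ (fromℕ n) ≈ 0#

  card : ∀ {N} → Subset N → Carrier
  card V = fromNat ∣ V ∣

  ConvexHull : ∀ {N m} → (Fin N → Vector Carrier m) → Subset N →
               Vector Carrier m → Set _
  ConvexHull {N} v V p = ∃ λ (x : Vector Carrier N) →
    (∀ i → 0# ≤ x i) ×
    (∀ {i} → i ∉ V → x i ≈ 0#) ×
    sum x ≈ 1# ×
    (∀ k → p k ≈ sum λ i → x i * v i k)

  card-pos : ∀ {N} {V : Subset N} → Nonempty V → 0# < card V
  card-pos {V = V} (i , i∈V) =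
    fromNat-pos ∣ V ∣ (≤<⇒0< (x∈p⇒∣p-x∣<∣p∣ i∈V))
    where
    ≤<⇒0< : ∀ {a b} → a ℕ.< b → 0 ℕ.< b
    ≤<⇒0< (ℕ.s≤s _) = ℕ.s≤s ℕ.z≤n

  module _ {n} {G : WeightedGraph (suc n)} (B : Eigenbasis G) where
    open Eigenbasis B

    √μ : Fin n → Carrier
    √μ k = √ (μ (inject₁ k)) (<⇒≤ (μ-pos k))

    √μ-pos : ∀ k → 0# < √μ k
    √μ-pos k = √-pos (μ (inject₁ k)) (μ-pos k)

    s : Fin (suc n) → Vector Carrier n
    s i k = z (inject₁ k) i * √μ k

    s⁺ : Fin (suc n) → Vector Carrier n
    s⁺ i k = z (inject₁ k) i / √μ k [ √μ-pos k ]

    centroid : (V : Subset (suc n)) → Nonempty V → Vector Carrier n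
    centroid V ne k =
      sum (λ i → if does (i ∈? V) then s i k else 0#)
        / card V [ card-pos ne ]

    Face⁺ : Subset (suc n) → Vector Carrier n → Set _
    Face⁺ = ConvexHull s⁺

    OrthogonalTo : Vector Carrier n → (Vector Carrier n → Set (c ⊔ ℓ₁ ⊔ ℓ₂)) →
                   Set _
    OrthogonalTo a F = ∀ p p′ → F p → F p′ → inner a (p ⊖ p′) ≈ 0#

    -- a is the altitude a⁺_V of the inverse simplex; it points from the face
    -- of V to the face of the complement.
    IsAltitude⁺ : Subset (suc n) → Vector Carrier n → Set _
    IsAltitude⁺ V a =
      (∃ λ p → ∃ λ q → Face⁺ (∁ V) p × Face⁺ V q × (∀ k → a k ≈ (p ⊖ q) k)) ×
      OrthogonalTo a (Face⁺ V) ×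
      OrthogonalTo a (Face⁺ (∁ V))

  -- Connectedness makes the weight of every cut positive, so that one may
  -- divide by it.
  module _ {N} (G : WeightedGraph N) where
    open WeightedGraph G

    crossing : ∀ (V : Subset N) {i j} → Star Link i j → i ∈ V → j ∉ V →
               ∃ λ a → ∃ λ b → Link a b × a ∈ V × b ∉ V
    crossing V ε                      i∈V j∉V = ⊥-elim (j∉V i∈V)
    crossing V (_◅_ {i} {k} l path) i∈V j∉V with k ∈? V
    ... | yes k∈V = crossing V path k∈V j∉V
    ... | no  k∉V = i , k , l , i∈V , k∉V

    private
      ite-zeroOrPos : ∀ {p} {P : Set p} (d : Dec P) {x} →
        (P → 0# < x) → ZeroOrPos (if does d then x else 0#)
      ite-zeroOrPos (yes p) h = inj₂ (h p)
      ite-zeroOrPos (no _)  h = inj₁ refl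

      ite-pos : ∀ {p} {P : Set p} (d : Dec P) {x} → P →
        0# < x → 0# < (if does d then x else 0#)
      ite-pos (yes _) p h = h
      ite-pos (no ¬p) p h = ⊥-elim (¬p p)

    ∂-weight-pos : Connected G → ∀ {V} → Nonempty V → V ⊂ ⊤ →
                   0# < weight G (∂? G V)
    ∂-weight-pos conn {V} (i , i∈V) (_ , j , _ , j∉V)
      with crossing V (conn i j) i∈V j∉V
    ... | a , b , l , a∈V , b∉V = go (Finₚ.<-cmp a b)
      where
      b∈∁V : b ∈ ∁ V
      b∈∁V = x∉p⇒x∈∁p b∉V

      counted? : ∀ i j → Dec (i Fin.< j × ∂ G V (i , j))
      counted? i j = (i <? j) ×-dec ∂? G V (i , j)

      term : ∀ i j → ZeroOrPos (if does (counted? i j) then w i j else 0#)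
      term i j = ite-zeroOrPos (counted? i j) λ (_ , l , _) → w-pos l

      from : ∀ i j → i Fin.< j → ∂ G V (i , j) → 0# < weight G (∂? G V)
      from i j i<j m = sum-pos _ (λ i → sum-zeroOrPos _ (term i)) i
        (sum-pos _ (term i) j
          (ite-pos (counted? i j) (i<j , m) (w-pos (proj₁ m))))

      go : Relation.Binary.Definitions.Tri (a Fin.< b) (a ≡ b) (b Fin.< a) →
           0# < weight G (∂? G V)
      go (tri< a<b _ _)    = from a b a<b (l , inj₁ (a∈V , b∈∁V))
      go (tri≈ _ ≡.refl _) = ⊥-elim (link-irrefl l)
      go (tri> _ _ b<a)    = from b a b<a (link-sym l , inj₂ (a∈V , b∈∁V))

{-# OPTIONS --safe #-}
module Submission where

-- With σ_V = Σ_{i ∈ V} s_i, the Gram matrix of the s_i is the Laplacian, so for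
-- disjoint node sets σ_U ∙ σ_V is minus the weight of the links between them,
-- and σ_V ∙ σ_V = |∂V| since σ_V = - σ_{∁V}.  The centroid of V is σ_V / |V|.
-- The s_i and s⁺_i are dual up to the constant eigenvector, which forces the
-- altitude of V to be - σ_V / |∂V|.

open import Defs
open import Algebra.Apartness.Bundles using (HeytingField; HeytingCommutativeRing)
open import Algebra.Bundles using (CommutativeRing)
import Algebra.Apartness.Properties.HeytingCommutativeRing as HCRProperties
import Algebra.Properties.CommutativeSemigroup as CommutativeSemigroupProperties
import Algebra.Properties.Ring as RingProperties
import Algebra.Properties.Semiring.Sum as SemiringSum
open import Data.Bool.Base using (if_then_else_)
open import Data.Empty using (⊥-elim)
open import Data.Fin.Base using (Fin; zero; suc; fromℕ; inject₁)
open import Data.Fin.Properties as Finₚ using (_≟_; _<?_)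
open import Data.Fin.Subset
  using (Subset; _∈_; _∉_; Nonempty; Empty; _⊂_; ⊤; ∁) renaming (_∩_ to _∩ₛ_)
open import Data.Fin.Subset.Properties
  using (_∈?_; x∈p∩q⁺; x∈p∩q⁻; x∈p⇒x∉∁p; x∈∁p⇒x∉p; x∉p⇒x∈∁p)
open import Data.Nat.Base as ℕ using (zero; suc)
open import Data.Product.Base using (_×_; _,_; proj₁; proj₂; ∃)
open import Data.Sum.Base using (_⊎_; inj₁; inj₂; [_,_]′)
open import Data.Vec.Functional using (Vector)
open import Function.Base using (_∘_)
open import Function.Bundles using (_⇔_; mk⇔)
open import Relation.Binary.Definitions using (tri<; tri≈; tri>)
import Relation.Binary.PropositionalEquality as ≡
import Relation.Binary.Reasoning.Setoid as ≈-Reasoning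
open import Relation.Binary.Structures using (IsStrictPartialOrder)
open import Relation.Nullary.Decidable
  using (Dec; yes; no; does; does-⇔; _×-dec_; _⊎-dec_)
open import Relation.Nullary.Negation using (¬_)
open import Relation.Unary using (_∩_; _≐_)
open import Relation.Unary.Properties using (_∩?_)

-- Two gaps separate the given eigenbasis from the Gram matrices. Orthonormality says ZZᵀ = I, with
-- the eigenvectors as rows of Z, but products of vertices sum over the eigenvalue index and need
-- ZᵀZ = I. Moreover `zₙ` is given only as a unit eigenvector for the eigenvalue 0, so its constancy
-- has to be derived. Signs cannot be decided in the constructive order, so vanishing is obtained
-- from tightness of apartness. Disjointness of the node sets acts three times: it removes the
-- degrees from the Laplacian form, it makes the two orientations of a link between the sets
-- exclusive, and it identifies the common links of the two cuts with the links between the sets. An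
-- altitude is any vector with the defining property, so its formula is a uniqueness statement: it
-- is derived from that property, and no altitude is constructed.

-- Finite sums, indicators and dot products over a commutative ring.

module CommutativeRingSums {c ℓ} (R : CommutativeRing c ℓ) where
  open CommutativeRing R hiding (zero)
  open SemiringSum semiring
  open RingProperties ring
  open CommutativeSemigroupProperties *-commutativeSemigroup
    using (xy∙z≈xz∙y)
  open ≈-Reasoning setoid

  -- As a ring factor, a condition obeys distributivity and can be moved through sums and products.
  𝟙 : ∀ {p} {P : Set p} → Dec P → Carrier
  𝟙 p? = if does p? then 1# else 0#

  if≈𝟙* : ∀ {p} {P : Set p} (p? : Dec P) x →
          (if does p? then x else 0#) ≈ 𝟙 p? * x
  if≈𝟙* (yes _) x = sym (*-identityˡ x)
  if≈𝟙* (no  _) x = sym (zeroˡ x)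

  𝟙-true : ∀ {p} {P : Set p} (p? : Dec P) → P → 𝟙 p? ≈ 1#
  𝟙-true (yes _) p = refl
  𝟙-true (no ¬p) p = ⊥-elim (¬p p)

  𝟙-false : ∀ {p} {P : Set p} (p? : Dec P) → ¬ P → 𝟙 p? ≈ 0#
  𝟙-false (yes p) ¬p = ⊥-elim (¬p p)
  𝟙-false (no _)  ¬p = refl

  𝟙-cong : ∀ {p q} {P : Set p} {Q : Set q} → P ⇔ Q →
           (p? : Dec P) (q? : Dec Q) → 𝟙 p? ≈ 𝟙 q?
  𝟙-cong e p? q? = reflexive
    (≡.cong (λ b → if b then 1# else 0#) (does-⇔ e p? q?))

  𝟙-× : ∀ {p q} {P : Set p} {Q : Set q} (p? : Dec P) (q? : Dec Q) →
        𝟙 (p? ×-dec q?) ≈ 𝟙 p? * 𝟙 q?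
  𝟙-× (yes _) q? = sym (*-identityˡ (𝟙 q?))
  𝟙-× (no  _) q? = sym (zeroˡ (𝟙 q?))

  𝟙-⊎ : ∀ {p q} {P : Set p} {Q : Set q} (p? : Dec P) (q? : Dec Q) →
        ¬ (P × Q) → 𝟙 (p? ⊎-dec q?) ≈ 𝟙 p? + 𝟙 q?
  𝟙-⊎ (yes p) q? ¬pq = sym (trans (+-congˡ (𝟙-false q? (λ q → ¬pq (p , q)))) (+-identityʳ 1#))
  𝟙-⊎ (no  _) q? ¬pq = sym (+-identityˡ (𝟙 q?))

  δ : ∀ {n} → Fin n → Fin n → Carrier
  δ i j = 𝟙 (i ≟ j)

  δ-sym : ∀ {n} (i j : Fin n) → δ i j ≈ δ j i
  δ-sym i j = 𝟙-cong (mk⇔ ≡.sym ≡.sym) (i ≟ j) (j ≟ i)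

  sum-zero : ∀ {n} {f : Vector Carrier n} → (∀ i → f i ≈ 0#) → sum f ≈ 0#
  sum-zero {n} h = trans (sum-cong-≋ h) (sum-replicate-zero n)

  sum-δ : ∀ {n} (i : Fin n) (f : Vector Carrier n) →
          sum (λ j → δ i j * f j) ≈ f i
  sum-δ zero    f = trans
    (+-cong (*-identityˡ (f zero)) (sum-zero (λ j → zeroˡ (f (suc j)))))
    (+-identityʳ (f zero))
  sum-δ (suc i) f = trans
    (+-cong (zeroˡ (f zero)) (sum-δ i (λ j → f (suc j))))
    (+-identityˡ (f (suc i)))

  sum-neg : ∀ {n} (f : Vector Carrier n) → sum (λ i → - f i) ≈ - sum f
  sum-neg f = begin
    sum (λ i → - f i)        ≈⟨ sum-cong-≋ (λ i → sym (-1*x≈-x (f i))) ⟩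
    sum (λ i → - 1# * f i)   ≈⟨ *-distribˡ-sum (- 1#) f ⟨
    - 1# * sum f             ≈⟨ -1*x≈-x (sum f) ⟩
    - sum f                  ∎

  sum-minus : ∀ {n} (f g : Vector Carrier n) →
              sum (λ i → f i - g i) ≈ sum f - sum g
  sum-minus f g = trans (∑-distrib-+ f (λ i → - g i)) (+-congˡ (sum-neg g))

  ∑∑-distrib-+ : ∀ {m n} (f g : Fin m → Fin n → Carrier) →
                 sum (λ i → sum (λ j → f i j + g i j)) ≈
                 sum (λ i → sum (f i)) + sum (λ i → sum (g i))
  ∑∑-distrib-+ f g = trans
    (sum-cong-≋ (λ i → ∑-distrib-+ (f i) (g i)))
    (∑-distrib-+ (λ i → sum (f i)) (λ i → sum (g i)))

  -- Associativity xᵀ(Ay) = (xᵀA)y of the matrix product.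
  sum-*-swap : ∀ {m n} (x : Vector Carrier m) (y : Vector Carrier n)
               (a : Fin m → Fin n → Carrier) →
               sum (λ i → x i * sum (λ j → a i j * y j)) ≈
               sum (λ j → sum (λ i → x i * a i j) * y j)
  sum-*-swap x y a = begin
    sum (λ i → x i * sum (λ j → a i j * y j))
      ≈⟨ sum-cong-≋ (λ i → *-distribˡ-sum (x i) (λ j → a i j * y j)) ⟩
    sum (λ i → sum (λ j → x i * (a i j * y j)))
      ≈⟨ ∑-comm (λ i j → x i * (a i j * y j)) ⟩
    sum (λ j → sum (λ i → x i * (a i j * y j)))
      ≈⟨ sum-cong-≋ (λ j → sum-cong-≋ (λ i → sym (*-assoc (x i) (a i j) (y j)))) ⟩
    sum (λ j → sum (λ i → x i * a i j * y j))
      ≈⟨ sum-cong-≋ (λ j → sym (*-distribʳ-sum (y j) (λ i → x i * a i j))) ⟩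
    sum (λ j → sum (λ i → x i * a i j) * y j) ∎

  infixl 7 _∙_
  _∙_ : ∀ {n} → Vector Carrier n → Vector Carrier n → Carrier
  x ∙ y = sum (λ i → x i * y i)

  combination : ∀ {m n} → Vector Carrier m → (Fin m → Vector Carrier n) →
                Vector Carrier n
  combination x v k = sum (λ i → x i * v i k)

  ∙-cong : ∀ {n} {x x′ y y′ : Vector Carrier n} →
           (∀ i → x i ≈ x′ i) → (∀ i → y i ≈ y′ i) → x ∙ y ≈ x′ ∙ y′
  ∙-cong p q = sum-cong-≋ (λ i → *-cong (p i) (q i))

  ∙-comm : ∀ {n} (x y : Vector Carrier n) → x ∙ y ≈ y ∙ x
  ∙-comm x y = sum-cong-≋ (λ i → *-comm (x i) (y i))

  ∙-minusʳ : ∀ {n} (a x y : Vector Carrier n) →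
             a ∙ (λ i → x i - y i) ≈ a ∙ x - a ∙ y
  ∙-minusʳ a x y = trans
    (sum-cong-≋ (λ i → x[y-z]≈xy-xz (a i) (x i) (y i)))
    (sum-minus (λ i → a i * x i) (λ i → a i * y i))

  ∙-negʳ : ∀ {n} (a x : Vector Carrier n) → a ∙ (λ i → - x i) ≈ - (a ∙ x)
  ∙-negʳ a x = trans
    (sum-cong-≋ (λ i → sym (-‿distribʳ-* (a i) (x i))))
    (sum-neg (λ i → a i * x i))

  ∙-*ʳ : ∀ {n} (x y : Vector Carrier n) t → x ∙ (λ i → y i * t) ≈ x ∙ y * t
  ∙-*ʳ x y t = trans
    (sum-cong-≋ (λ i → sym (*-assoc (x i) (y i) t)))
    (sym (*-distribʳ-sum t (λ i → x i * y i)))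

  ∙-*ˡ : ∀ {n} (x y : Vector Carrier n) t → (λ i → x i * t) ∙ y ≈ x ∙ y * t
  ∙-*ˡ x y t = trans
    (sum-cong-≋ (λ i → xy∙z≈xz∙y (x i) t (y i)))
    (sym (*-distribʳ-sum t (λ i → x i * y i)))

  ∙-* : ∀ {n} (x y : Vector Carrier n) t u →
        (λ i → x i * t) ∙ (λ i → y i * u) ≈ x ∙ y * (t * u)
  ∙-* x y t u = begin
    (λ i → x i * t) ∙ (λ i → y i * u) ≈⟨ ∙-*ʳ (λ i → x i * t) y u ⟩
    (λ i → x i * t) ∙ y * u           ≈⟨ *-congʳ (∙-*ˡ x y t) ⟩
    x ∙ y * t * u                     ≈⟨ *-assoc (x ∙ y) t u ⟩
    x ∙ y * (t * u)                   ∎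

  ∙-combinationʳ : ∀ {m n} (a : Vector Carrier n) (x : Vector Carrier m)
                   (v : Fin m → Vector Carrier n) →
                   a ∙ combination x v ≈ sum (λ i → x i * (a ∙ v i))
  ∙-combinationʳ a x v = begin
    sum (λ k → a k * sum (λ i → x i * v i k))
      ≈⟨ sum-cong-≋ (λ k → *-congˡ (∙-comm x (λ i → v i k))) ⟩
    sum (λ k → a k * sum (λ i → v i k * x i))
      ≈⟨ sum-*-swap a x (λ k i → v i k) ⟩
    sum (λ i → (a ∙ v i) * x i)
      ≈⟨ ∙-comm (λ i → a ∙ v i) x ⟩
    sum (λ i → x i * (a ∙ v i)) ∎

  ∙-combinationˡ : ∀ {m n} (x : Vector Carrier m)
                   (v : Fin m → Vector Carrier n) (a : Vector Carrier n) →
                   combination x v ∙ a ≈ sum (λ i → x i * (v i ∙ a))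
  ∙-combinationˡ x v a = begin
    combination x v ∙ a           ≈⟨ ∙-comm (combination x v) a ⟩
    a ∙ combination x v           ≈⟨ ∙-combinationʳ a x v ⟩
    sum (λ i → x i * (a ∙ v i))   ≈⟨ sum-cong-≋ (λ i → *-congˡ (∙-comm a (v i))) ⟩
    sum (λ i → x i * (v i ∙ a))   ∎

-- Constructive order, squares, and completeness of orthonormal families.

module OrderedFieldProperties {c ℓ₁ ℓ₂} (F : OrderedField c ℓ₁ ℓ₂) where
  open OrderedField F hiding (zero)

  commutativeRing : CommutativeRing c ℓ₁
  commutativeRing = HeytingCommutativeRing.commutativeRing
    (HeytingField.heytingCommutativeRing heytingField)

  open HCRProperties (HeytingField.heytingCommutativeRing heytingField)
  open SemiringSum semiring
  open RingProperties ring
  open CommutativeRingSums commutativeRing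
  open IsStrictPartialOrder isStrictPartialOrder
    using (<-respʳ-≈; <-respˡ-≈) renaming (irrefl to <-irrefl; trans to <-trans)

  -- The two negated strict inequalities exclude apartness, and apartness is tight.
  ≤-antisym : ∀ {x y} → x ≤ y → y ≤ x → x ≈ y
  ≤-antisym {x} {y} x≤y y≤x = proj₁ (tight x y) λ x#y → [ y≤x , x≤y ]′ (#⇒<⊎> x#y)

  0<x⇒y<x+y : ∀ {x} y → 0# < x → y < x + y
  0<x⇒y<x+y y 0<x = <-respˡ-≈ (+-identityˡ y) (+-monoˡ-< y 0<x)

  x+y<x⇒y<0 : ∀ {x y} → x + y < x → y < 0#
  x+y<x⇒y<0 {x} {y} p = <-respʳ-≈ (-‿inverseʳ x)
    (<-respˡ-≈ (xyx⁻¹≈y x y) (+-monoˡ-< (- x) p))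

  -- If x + y < 0, cotransitivity at x replaces the missing trichotomy: x is apart from x + y or
  -- from 0, and each resulting inequality makes x or y negative.
  +-nonneg : ∀ {x y} → 0# ≤ x → 0# ≤ y → 0# ≤ x + y
  +-nonneg {x} {y} 0≤x 0≤y x+y<0 with #-cotrans (<⇒# x+y<0) x
  ... | inj₁ x+y#x = [ 0≤y ∘ x+y<x⇒y<0 , (λ x<x+y → 0≤x (<-trans x<x+y x+y<0)) ]′
                       (#⇒<⊎> x+y#x)
  ... | inj₂ x#0 = [ 0≤x , (λ 0<x → 0≤y (<-trans (0<x⇒y<x+y y 0<x) x+y<0)) ]′
                     (#⇒<⊎> x#0)

  sum-nonneg : ∀ {n} (f : Vector Carrier n) → (∀ i → 0# ≤ f i) → 0# ≤ sum f
  sum-nonneg {zero}  f h = <-irrefl refl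
  sum-nonneg {suc n} f h = +-nonneg (h zero) (sum-nonneg (f ∘ suc) (h ∘ suc))

  -- A positive first term would push the remaining sum below the total 0, although that sum is
  -- non-negative.
  nonneg-sum≈0⇒≈0 : ∀ {n} (f : Vector Carrier n) → (∀ i → 0# ≤ f i) →
                    sum f ≈ 0# → ∀ i → f i ≈ 0#
  nonneg-sum≈0⇒≈0 {suc n} f h Σ≈0 = λ where
      zero    → f₀≈0
      (suc i) → nonneg-sum≈0⇒≈0 (f ∘ suc) (h ∘ suc)
                  (trans (sym (trans (+-congʳ f₀≈0) (+-identityˡ _))) Σ≈0) i
    where
    f₀≈0 : f zero ≈ 0#
    f₀≈0 = ≤-antisym
      (λ 0<f₀ → sum-nonneg (f ∘ suc) (h ∘ suc) (<-respʳ-≈ Σ≈0 (0<x⇒y<x+y _ 0<f₀)))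
      (h zero)

  x#0⇒0<x² : ∀ {x} → x # 0# → 0# < x * x
  x#0⇒0<x² {x} x#0 with #⇒<⊎> x#0
  ... | inj₂ 0<x = *-pos 0<x 0<x
  ... | inj₁ x<0 = <-respʳ-≈ -x²≈x² (*-pos 0<-x 0<-x)
    where
    0<-x : 0# < - x
    0<-x = <-respˡ-≈ (-‿inverseʳ x)
             (<-respʳ-≈ (+-identityˡ (- x)) (+-monoˡ-< (- x) x<0))
    -x²≈x² : - x * - x ≈ x * x
    -x²≈x² = trans (sym (-‿distribˡ-* x (- x)))
      (trans (-‿cong (sym (-‿distribʳ-* x x))) (-‿involutive (x * x)))

  square-nonneg : ∀ x → 0# ≤ x * x
  square-nonneg x x²<0 = <-irrefl refl (<-trans (x#0⇒0<x² x#0) x²<0)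
    where
    x#0 : x # 0#
    x#0 with y , _ , x²y≈1 ← #⇒invertible (<⇒# x²<0) = invertibleʳ⇒#
      ( x * y
      , trans (*-congʳ (x-0≈x x)) (trans (sym (*-assoc x x y))
          (trans (*-congʳ (sym (x-0≈x (x * x)))) x²y≈1)))

  x²≈0⇒x≈0 : ∀ {x} → x * x ≈ 0# → x ≈ 0#
  x²≈0⇒x≈0 {x} x²≈0 = proj₁ (tight x 0#) λ x#0 →
    <-irrefl (sym x²≈0) (x#0⇒0<x² x#0)

  -- The residual E = I - ZᵀZ satisfies EEᵀ = E because EZᵀ = 0, and its trace
  -- is 0 because ZᵀZ and ZZᵀ = I have equal traces.  So the sum of the squares
  -- of the entries of E vanishes, and no determinants are needed.
  orthonormal⇒complete : ∀ {n} (z : Fin n → Vector Carrier n) →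
    (∀ k l → z k ∙ z l ≈ δ k l) →
    ∀ i j → sum (λ k → z k i * z k j) ≈ δ i j
  orthonormal⇒complete {n} z orth i j = sym (x∙y⁻¹≈ε⇒x≈y _ _ (E≈0 i j))
    where
    open ≈-Reasoning setoid

    P E : Fin n → Fin n → Carrier
    P i j = sum λ k → z k i * z k j
    E i j = δ i j - P i j

    Pz≈z : ∀ i k → P i ∙ z k ≈ z k i
    Pz≈z i k = begin
      sum (λ j → P i j * z k j)
        ≈⟨ sum-*-swap (λ l → z l i) (z k) z ⟨
      sum (λ l → z l i * (z l ∙ z k))
        ≈⟨ sum-cong-≋ (λ l → trans (*-congˡ (trans (orth l k) (δ-sym l k)))
             (*-comm (z l i) (δ k l))) ⟩
      sum (λ l → δ k l * z l i)
        ≈⟨ sum-δ k (λ l → z l i) ⟩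
      z k i ∎

    Ez≈0 : ∀ i k → E i ∙ z k ≈ 0#
    Ez≈0 i k = begin
      E i ∙ z k             ≈⟨ ∙-comm (E i) (z k) ⟩
      z k ∙ E i             ≈⟨ ∙-minusʳ (z k) (δ i) (P i) ⟩
      z k ∙ δ i - z k ∙ P i ≈⟨ +-cong (trans (∙-comm (z k) (δ i)) (sum-δ i (z k)))
                                 (-‿cong (trans (∙-comm (z k) (P i)) (Pz≈z i k))) ⟩
      z k i - z k i         ≈⟨ -‿inverseʳ (z k i) ⟩
      0#                    ∎

    EP≈0 : ∀ i j → E i ∙ P j ≈ 0#
    EP≈0 i j = begin
      sum (λ l → E i l * sum (λ k → z k j * z k l))
        ≈⟨ ∙-combinationʳ (E i) (λ k → z k j) z ⟩
      sum (λ k → z k j * (E i ∙ z k))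
        ≈⟨ sum-zero (λ k → trans (*-congˡ (Ez≈0 i k)) (zeroʳ (z k j))) ⟩
      0# ∎

    EE≈E : ∀ i → E i ∙ E i ≈ E i i
    EE≈E i = begin
      E i ∙ E i             ≈⟨ ∙-minusʳ (E i) (δ i) (P i) ⟩
      E i ∙ δ i - E i ∙ P i ≈⟨ +-cong (trans (∙-comm (E i) (δ i)) (sum-δ i (E i)))
                                 (-‿cong (EP≈0 i i)) ⟩
      E i i - 0#            ≈⟨ x-0≈x (E i i) ⟩
      E i i                 ∎

    trace : (Fin n → Fin n → Carrier) → Carrier
    trace A = sum λ i → A i i

    trace-P : trace P ≈ trace δ
    trace-P = begin
      trace P                               ≈⟨ ∑-comm (λ i k → z k i * z k i) ⟩
      sum (λ k → z k ∙ z k)                 ≈⟨ sum-cong-≋ (λ k → orth k k) ⟩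
      trace δ                               ∎

    ∑EE≈0 : sum (λ i → E i ∙ E i) ≈ 0#
    ∑EE≈0 = begin
      sum (λ i → E i ∙ E i)   ≈⟨ sum-cong-≋ EE≈E ⟩
      trace E                 ≈⟨ sum-minus (λ i → δ i i) (λ i → P i i) ⟩
      trace δ - trace P       ≈⟨ +-congˡ (-‿cong trace-P) ⟩
      trace δ - trace δ       ≈⟨ -‿inverseʳ (trace δ) ⟩
      0#                      ∎

    E≈0 : ∀ i j → E i j ≈ 0#
    E≈0 i j = x²≈0⇒x≈0
      (nonneg-sum≈0⇒≈0 _ (λ j → square-nonneg (E i j))
        (nonneg-sum≈0⇒≈0 (λ i → E i ∙ E i)
          (λ i → sum-nonneg _ (λ j → square-nonneg (E i j))) ∑EE≈0 i) j)

-- The Laplacian form on indicator vectors and the weight of cuts.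

module LaplacianCuts {c ℓ₁ ℓ₂} (ℝ : Reals c ℓ₁ ℓ₂) where
  open GraphGeometry ℝ
  open OrderedFieldProperties orderedField using (commutativeRing)
  open CommutativeRingSums commutativeRing
  open RingProperties ring
  open SemiringSum semiring
    using (sum-cong-≋; ∑-comm)
  open ≈-Reasoning setoid

  χ : ∀ {N} → Subset N → Fin N → Carrier
  χ V i = 𝟙 (i ∈? V)

  χ-disjoint : ∀ {N} {U V : Subset N} → Empty (U ∩ₛ V) → ∀ i → χ U i * χ V i ≈ 0#
  χ-disjoint {U = U} {V} ¬UV i = trans (sym (𝟙-× (i ∈? U) (i ∈? V)))
    (𝟙-false ((i ∈? U) ×-dec (i ∈? V)) λ i∈UV → ¬UV (i , x∈p∩q⁺ i∈UV))

  χ-∁ : ∀ {N} (V : Subset N) i → χ V i + χ (∁ V) i ≈ 1#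
  χ-∁ V i with i ∈? V
  ... | yes i∈V = trans (+-congˡ (𝟙-false (i ∈? ∁ V) (x∈p⇒x∉∁p i∈V))) (+-identityʳ 1#)
  ... | no  i∉V = trans (+-congˡ (𝟙-true (i ∈? ∁ V) (x∉p⇒x∈∁p i∉V))) (+-identityˡ 1#)

  module _ {N} (G : WeightedGraph N) where
    open WeightedGraph G

    adjacency : Fin N → Fin N → Carrier
    adjacency i j = if does (link? i j) then w i j else 0#

    adjacency-sym : ∀ i j → adjacency i j ≈ adjacency j i
    adjacency-sym i j = if-cong (link? i j) (link? j i) link-sym link-sym w-sym
      where
      if-cong : ∀ {p q} {P : Set p} {Q : Set q} (p? : Dec P) (q? : Dec Q) {x y} →
        (P → Q) → (Q → P) → (P → x ≈ y) →
        (if does p? then x else 0#) ≈ (if does q? then y else 0#)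
      if-cong (yes p) (yes q) f g h = h p
      if-cong (yes p) (no ¬q) f g h = ⊥-elim (¬q (f p))
      if-cong (no ¬p) (yes q) f g h = ⊥-elim (¬p (g q))
      if-cong (no ¬p) (no ¬q) f g h = refl

    adjacency-irrefl : ∀ i → adjacency i i ≈ 0#
    adjacency-irrefl i = trans (if≈𝟙* (link? i i) (w i i))
      (trans (*-congʳ (𝟙-false (link? i i) link-irrefl)) (zeroˡ (w i i)))

    -- This is Q = D - A. The definition tests the diagonal before the links, so the two sides agree
    -- there because a node is never linked to itself.
    laplacian≈ : ∀ i j → laplacian G i j ≈ δ i j * degree G i - adjacency i j
    laplacian≈ i j = cases (i ≟ j) (link? i j) λ where ≡.refl → link-irrefl
      where
      cases : ∀ {p q} {P : Set p} {Q : Set q} (p? : Dec P) (q? : Dec Q) {x y} →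
        (P → ¬ Q) →
        (if does p? then x else if does q? then - y else 0#) ≈
        𝟙 p? * x - (if does q? then y else 0#)
      cases (yes p) (yes q) ¬pq = ⊥-elim (¬pq p q)
      cases (yes p) (no  _) ¬pq = sym (trans (+-cong (*-identityˡ _) -0#≈0#) (+-identityʳ _))
      cases (no  _) (yes _) ¬pq = sym (trans (+-congʳ (zeroˡ _)) (+-identityˡ _))
      cases (no  _) (no  _) ¬pq = sym (trans (+-cong (zeroˡ _) -0#≈0#) (+-identityʳ _))

    laplacian-sym : ∀ i j → laplacian G i j ≈ laplacian G j i
    laplacian-sym i j = begin
      laplacian G i j                     ≈⟨ laplacian≈ i j ⟩
      δ i j * degree G i - adjacency i j  ≈⟨ +-cong δ*degree-sym (-‿cong (adjacency-sym i j)) ⟩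
      δ j i * degree G j - adjacency j i  ≈⟨ laplacian≈ j i ⟨
      laplacian G j i                     ∎
      where
      δ*degree-sym : δ i j * degree G i ≈ δ j i * degree G j
      δ*degree-sym with i ≟ j
      ... | yes ≡.refl = *-congʳ (sym (𝟙-true (i ≟ i) ≡.refl))
      ... | no  i≢j    = trans (zeroˡ _)
        (sym (trans (*-congʳ (𝟙-false (j ≟ i) (i≢j ∘ ≡.sym))) (zeroˡ _)))

    laplacian-row : ∀ i → sum (laplacian G i) ≈ 0#
    laplacian-row i = begin
      sum (laplacian G i)
        ≈⟨ sum-cong-≋ (laplacian≈ i) ⟩
      sum (λ j → δ i j * degree G i - adjacency i j)
        ≈⟨ sum-minus (λ j → δ i j * degree G i) (adjacency i) ⟩
      sum (λ j → δ i j * degree G i) - degree G i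
        ≈⟨ +-congʳ (sum-δ i (λ _ → degree G i)) ⟩
      degree G i - degree G i
        ≈⟨ -‿inverseʳ (degree G i) ⟩
      0# ∎

    laplacian-column : ∀ j → sum (λ i → laplacian G i j) ≈ 0#
    laplacian-column j = trans (sum-cong-≋ (λ i → laplacian-sym i j)) (laplacian-row j)

    module _ (U V : Subset N) (¬UV : Empty (U ∩ₛ V)) where

      -- The summand of χ_Uᵀ A χ_V. It runs over ordered pairs, whereas `weight` runs over pairs
      -- with i < j; the lemmas below reconcile the two counts.
      cutTerm : Fin N → Fin N → Carrier
      cutTerm i j = χ U i * (χ V j * adjacency i j)

      cutTerm-irrefl : ∀ i → cutTerm i i ≈ 0#
      cutTerm-irrefl i = trans
        (*-congˡ (trans (*-congˡ (adjacency-irrefl i)) (zeroʳ (χ V i)))) (zeroʳ (χ U i))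

      -- The degree on the diagonal is multiplied by χ_U χ_V at one node, which is 0 for disjoint
      -- sets. Off the diagonal the Laplacian is minus the adjacency matrix.
      laplacian-cutTerm : ∀ i j → χ U i * (χ V j * laplacian G i j) ≈ - cutTerm i j
      laplacian-cutTerm i j with i ≟ j
      ... | yes ≡.refl = begin
        χ U i * (χ V i * degree G i)  ≈⟨ *-assoc (χ U i) (χ V i) (degree G i) ⟨
        χ U i * χ V i * degree G i    ≈⟨ *-congʳ (χ-disjoint ¬UV i) ⟩
        0# * degree G i               ≈⟨ zeroˡ (degree G i) ⟩
        0#                            ≈⟨ -0#≈0# ⟨
        - 0#                          ≈⟨ -‿cong (cutTerm-irrefl i) ⟨
        - cutTerm i i                 ∎
      ... | no _ = begin
        χ U i * (χ V j * (if does (link? i j) then - w i j else 0#))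
          ≈⟨ *-congˡ (*-congˡ (if-neg (link? i j))) ⟩
        χ U i * (χ V j * - adjacency i j)
          ≈⟨ *-congˡ (-‿distribʳ-* (χ V j) (adjacency i j)) ⟨
        χ U i * - (χ V j * adjacency i j)
          ≈⟨ -‿distribʳ-* (χ U i) (χ V j * adjacency i j) ⟨
        - cutTerm i j ∎
        where
        if-neg : ∀ {p} {P : Set p} (p? : Dec P) {x} →
          (if does p? then - x else 0#) ≈ - (if does p? then x else 0#)
        if-neg (yes _) = refl
        if-neg (no _)  = sym -0#≈0#

      -- An unordered link may meet U at either end. Both orientations at once would put a node in U
      -- and V, so the indicator of the disjunction is a sum.
      weight-term : ∀ i j →
        (if does ((i <? j) ×-dec between? G U V (i , j)) then w i j else 0#) ≈
        𝟙 (i <? j) * cutTerm i j + 𝟙 (i <? j) * cutTerm j i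
      weight-term i j = begin
        (if does ((i <? j) ×-dec between? G U V (i , j)) then w i j else 0#)
          ≈⟨ if≈𝟙* ((i <? j) ×-dec between? G U V (i , j)) (w i j) ⟩
        𝟙 ((i <? j) ×-dec between? G U V (i , j)) * w i j
          ≈⟨ *-congʳ (𝟙-× (i <? j) (between? G U V (i , j))) ⟩
        u * 𝟙 (between? G U V (i , j)) * w i j
          ≈⟨ *-congʳ (*-congˡ (𝟙-× (link? i j) ends?)) ⟩
        u * (l * 𝟙 ends?) * w i j
          ≈⟨ *-assoc u (l * 𝟙 ends?) (w i j) ⟩
        u * (l * 𝟙 ends? * w i j)
          ≈⟨ *-congˡ (xy∙z≈y∙xz l (𝟙 ends?) (w i j)) ⟩
        u * (𝟙 ends? * (l * w i j))
          ≈⟨ *-congˡ (*-cong ends≈ (sym (if≈𝟙* (link? i j) (w i j)))) ⟩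
        u * ((χ U i * χ V j + χ U j * χ V i) * adjacency i j)
          ≈⟨ *-congˡ (distribʳ (adjacency i j) (χ U i * χ V j) (χ U j * χ V i)) ⟩
        u * (χ U i * χ V j * adjacency i j + χ U j * χ V i * adjacency i j)
          ≈⟨ *-congˡ (+-cong (*-assoc (χ U i) (χ V j) (adjacency i j))
               (trans (*-congˡ (adjacency-sym i j)) (*-assoc (χ U j) (χ V i) (adjacency j i)))) ⟩
        u * (cutTerm i j + cutTerm j i)
          ≈⟨ distribˡ u (cutTerm i j) (cutTerm j i) ⟩
        u * cutTerm i j + u * cutTerm j i ∎
        where
        open CommutativeSemigroupProperties
          (CommutativeRing.*-commutativeSemigroup commutativeRing) using (xy∙z≈y∙xz)
        u l : Carrier
        u = 𝟙 (i <? j)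
        l = 𝟙 (link? i j)
        ends? : Dec ((i ∈ U × j ∈ V) ⊎ (j ∈ U × i ∈ V))
        ends? = ((i ∈? U) ×-dec (j ∈? V)) ⊎-dec ((j ∈? U) ×-dec (i ∈? V))
        ends≈ : 𝟙 ends? ≈ χ U i * χ V j + χ U j * χ V i
        ends≈ = trans
          (𝟙-⊎ ((i ∈? U) ×-dec (j ∈? V)) ((j ∈? U) ×-dec (i ∈? V))
            λ ((i∈U , _) , (_ , i∈V)) → ¬UV (i , x∈p∩q⁺ (i∈U , i∈V)))
          (+-cong (𝟙-× (i ∈? U) (j ∈? V)) (𝟙-× (j ∈? U) (i ∈? V)))

      -- An ordered pair lies in exactly one of the two triangles unless it is diagonal, where the
      -- term itself vanishes.
      cutTerm-split : ∀ i j →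
        𝟙 (i <? j) * cutTerm i j + 𝟙 (j <? i) * cutTerm i j ≈ cutTerm i j
      cutTerm-split i j with Finₚ.<-cmp i j
      ... | tri< i<j _ j≮i = trans
        (+-cong (trans (*-congʳ (𝟙-true (i <? j) i<j)) (*-identityˡ _))
                (trans (*-congʳ (𝟙-false (j <? i) j≮i)) (zeroˡ _)))
        (+-identityʳ _)
      ... | tri> i≮j _ j<i = trans
        (+-cong (trans (*-congʳ (𝟙-false (i <? j) i≮j)) (zeroˡ _))
                (trans (*-congʳ (𝟙-true (j <? i) j<i)) (*-identityˡ _)))
        (+-identityˡ _)
      ... | tri≈ _ ≡.refl _ = trans
        (+-cong (trans (*-congˡ (cutTerm-irrefl i)) (zeroʳ _))
                (trans (*-congˡ (cutTerm-irrefl i)) (zeroʳ _)))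
        (trans (+-identityˡ 0#) (sym (cutTerm-irrefl i)))

      weight-between : weight G (between? G U V) ≈ sum (λ i → sum (cutTerm i))
      weight-between = begin
        weight G (between? G U V)
          ≈⟨ sum-cong-≋ (λ i → sum-cong-≋ (weight-term i)) ⟩
        sum (λ i → sum (λ j → up i j * cutTerm i j + up i j * cutTerm j i))
          ≈⟨ ∑∑-distrib-+ (λ i j → up i j * cutTerm i j) (λ i j → up i j * cutTerm j i) ⟩
        sum (λ i → sum (λ j → up i j * cutTerm i j)) +
        sum (λ i → sum (λ j → up i j * cutTerm j i))
          -- Exchanging the summations turns the reversed orientation into the lower triangle of the
          -- same matrix.
          ≈⟨ +-congˡ (∑-comm (λ i j → up i j * cutTerm j i)) ⟩
        sum (λ i → sum (λ j → up i j * cutTerm i j)) +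
        sum (λ i → sum (λ j → up j i * cutTerm i j))
          ≈⟨ ∑∑-distrib-+ (λ i j → up i j * cutTerm i j) (λ i j → up j i * cutTerm i j) ⟨
        sum (λ i → sum (λ j → up i j * cutTerm i j + up j i * cutTerm i j))
          ≈⟨ sum-cong-≋ (λ i → sum-cong-≋ (cutTerm-split i)) ⟩
        sum (λ i → sum (cutTerm i)) ∎
        where
        up : Fin N → Fin N → Carrier
        up i j = 𝟙 (i <? j)

      laplacian-between :
        sum (λ i → sum (λ j → χ U i * (χ V j * laplacian G i j))) ≈
        - weight G (between? G U V)
      laplacian-between = begin
        sum (λ i → sum (λ j → χ U i * (χ V j * laplacian G i j)))
          ≈⟨ sum-cong-≋ (λ i → sum-cong-≋ (laplacian-cutTerm i)) ⟩
        sum (λ i → sum (λ j → - cutTerm i j))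
          ≈⟨ sum-cong-≋ (λ i → sum-neg (cutTerm i)) ⟩
        sum (λ i → - sum (cutTerm i))
          ≈⟨ sum-neg (λ i → sum (cutTerm i)) ⟩
        - sum (λ i → sum (cutTerm i))
          ≈⟨ -‿cong weight-between ⟨
        - weight G (between? G U V) ∎

      -- The end in U and the end in V cannot be the same node, so a link of both cuts joins the two
      -- sets. Conversely, disjointness puts each end in the complement of the other set.
      ∂∩∂≐between : ∂ G U ∩ ∂ G V ≐ between G U V
      ∂∩∂≐between = to , from
        where
        ∉both : ∀ {i} → i ∈ U → i ∉ V
        ∉both i∈U i∈V = ¬UV (_ , x∈p∩q⁺ (i∈U , i∈V))
        to : ∀ {e} → (∂ G U ∩ ∂ G V) e → between G U V e
        to ((l , inj₁ (i∈U , _)) , (_ , inj₁ (i∈V , _))) = ⊥-elim (∉both i∈U i∈V)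
        to ((l , inj₁ (i∈U , _)) , (_ , inj₂ (j∈V , _))) = l , inj₁ (i∈U , j∈V)
        to ((l , inj₂ (j∈U , _)) , (_ , inj₁ (i∈V , _))) = l , inj₂ (j∈U , i∈V)
        to ((l , inj₂ (j∈U , _)) , (_ , inj₂ (j∈V , _))) = ⊥-elim (∉both j∈U j∈V)
        from : ∀ {e} → between G U V e → (∂ G U ∩ ∂ G V) e
        from (l , inj₁ (i∈U , j∈V)) =
          (l , inj₁ (i∈U , x∉p⇒x∈∁p λ j∈U → ∉both j∈U j∈V)) ,
          (l , inj₂ (j∈V , x∉p⇒x∈∁p (∉both i∈U)))
        from (l , inj₂ (j∈U , i∈V)) =
          (l , inj₂ (j∈U , x∉p⇒x∈∁p λ i∈U → ∉both i∈U i∈V)) ,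
          (l , inj₁ (i∈V , x∉p⇒x∈∁p (∉both j∈U)))

      -- `weight` sees a decision procedure only through its booleans, and these agree for
      -- equivalent predicates.
      weight-∂∩∂ : weight G (∂? G U ∩? ∂? G V) ≈ weight G (between? G U V)
      weight-∂∩∂ = sum-cong-≋ λ i → sum-cong-≋ λ j → reflexive
        (≡.cong (λ b → if b then w i j else 0#)
          (does-⇔ (mk⇔ (λ (i<j , e) → i<j , proj₁ ∂∩∂≐between e)
                       (λ (i<j , e) → i<j , proj₂ ∂∩∂≐between e))
            ((i <? j) ×-dec (∂? G U ∩? ∂? G V) (i , j))
            ((i <? j) ×-dec between? G U V (i , j))))

-- Gram matrices of the two simplices, centroids and altitudes.

module SimplexGeometry {c ℓ₁ ℓ₂} (ℝ : Reals c ℓ₁ ℓ₂) where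
  open GraphGeometry ℝ
  open OrderedFieldProperties orderedField using (commutativeRing; orthonormal⇒complete)
  open CommutativeRingSums commutativeRing
  open LaplacianCuts ℝ
  open RingProperties ring
  open CommutativeSemigroupProperties
    (CommutativeRing.*-commutativeSemigroup commutativeRing)
  open SemiringSum semiring
    using (sum-cong-≋; sum-init-last; ∑-distrib-+; ∑-comm; *-distribˡ-sum; *-distribʳ-sum)
  open ≈-Reasoning setoid

  *-cancel-pos : ∀ x {y} → 0# < x → x * y ≈ 0# → y ≈ 0#
  *-cancel-pos x {y} 0<x xy≈0 = begin
    y                       ≈⟨ *-identityˡ y ⟨
    1# * y                  ≈⟨ *-congʳ (⁻¹-inverseˡ x 0<x) ⟨
    x ⁻¹[ 0<x ] * x * y     ≈⟨ *-assoc _ x y ⟩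
    x ⁻¹[ 0<x ] * (x * y)   ≈⟨ *-congˡ xy≈0 ⟩
    x ⁻¹[ 0<x ] * 0#        ≈⟨ zeroʳ _ ⟩
    0#                      ∎

  ⁻¹-unique : ∀ {x y} (p : 0# < x) → y * x ≈ 1# → y ≈ x ⁻¹[ p ]
  ⁻¹-unique {x} {y} p yx≈1 = begin
    y                       ≈⟨ *-identityʳ y ⟨
    y * 1#                  ≈⟨ *-congˡ (⁻¹-inverseˡ x p) ⟨
    y * (x ⁻¹[ p ] * x)     ≈⟨ x∙yz≈xz∙y y _ x ⟩
    y * x * x ⁻¹[ p ]       ≈⟨ *-congʳ yx≈1 ⟩
    1# * x ⁻¹[ p ]          ≈⟨ *-identityˡ _ ⟩
    x ⁻¹[ p ]               ∎

  -- The common last step for centroids and altitudes: both are multiples of vectors `σ`, and only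
  -- the product of the two scalars matters.
  ∙-scaled : ∀ {m} {a b x y : Vector Carrier m} {W t u r} (p : 0# < r) →
    (∀ k → a k ≈ x k * t) → (∀ k → b k ≈ y k * u) →
    x ∙ y ≈ - W → t * u * r ≈ 1# → inner a b ≈ - (W / r [ p ])
  ∙-scaled {a = a} {b} {x} {y} {W} {t} {u} {r} p a≈ b≈ xy≈-W tur≈1 = begin
    a ∙ b                                ≈⟨ ∙-cong a≈ b≈ ⟩
    (λ k → x k * t) ∙ (λ k → y k * u)    ≈⟨ ∙-* x y t u ⟩
    x ∙ y * (t * u)                      ≈⟨ *-cong xy≈-W (⁻¹-unique p tur≈1) ⟩
    - W * r ⁻¹[ p ]                      ≈⟨ -‿distribˡ-* W _ ⟨
    - (W / r [ p ])                      ∎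

  δ-nonneg : ∀ {N} (i j : Fin N) → 0# ≤ δ i j
  δ-nonneg i j with i ≟ j
  ... | yes _ = <⇒≤ 0<1
  ... | no  _ = <-irrefl refl

  -- Allows orthogonality to a face to be tested on differences of its vertices.
  vertex∈hull : ∀ {N m} (v : Fin N → Vector Carrier m) {V i} → i ∈ V →
                ConvexHull v V (v i)
  vertex∈hull v {V} {i} i∈V =
    δ i , δ-nonneg i
    , (λ {j} j∉V → 𝟙-false (i ≟ j) λ { ≡.refl → j∉V i∈V })
    , trans (sum-cong-≋ (λ j → sym (*-identityʳ (δ i j)))) (sum-δ i (λ _ → 1#))
    , (λ k → sym (sum-δ i (λ j → v j k)))

  module _ {n} {G : WeightedGraph (suc n)} (B : Eigenbasis G) where
    open Eigenbasis B

    zₙ : Vector Carrier (suc n)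
    zₙ = z (fromℕ n)

    complete-z : ∀ i j → sum (λ k → z k i * z k j) ≈ δ i j
    complete-z = orthonormal⇒complete z orthonormal

    -- The spectral decomposition Q = Σ μ_k z_k z_kᵀ, which follows from Q z_k = μ_k z_k by
    -- completeness.
    s∙s≈laplacian : ∀ i j → s B i ∙ s B j ≈ laplacian G i j
    s∙s≈laplacian i j = begin
      s B i ∙ s B j
        ≈⟨ sum-cong-≋ (λ k → trans (interchange (zᵢ k) (√μ B k) (zⱼ k) (√μ B k))
             (trans (*-congˡ (√-square _ _)) (xy∙z≈zx∙y (zᵢ k) (zⱼ k) _))) ⟩
      sum (λ k → term (inject₁ k))
        ≈⟨ +-identityʳ _ ⟨
      sum (λ k → term (inject₁ k)) + 0#
        -- The vertices have only N - 1 coordinates; the missing N-th term is supplied for free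
        -- because its eigenvalue is 0.
        ≈⟨ +-congˡ (trans (*-congʳ (trans (*-congʳ μ-last) (zeroˡ (zₙ i)))) (zeroˡ (zₙ j))) ⟨
      sum (λ k → term (inject₁ k)) + term (fromℕ n)
        ≈⟨ sum-init-last term ⟨
      sum term
        ≈⟨ sum-cong-≋ (λ k → *-congʳ {z k j} (eigen k i)) ⟨
      sum (λ k → sum (λ l → laplacian G i l * z k l) * z k j)
        ≈⟨ sum-*-swap (laplacian G i) (λ k → z k j) (λ l k → z k l) ⟨
      sum (λ l → laplacian G i l * sum (λ k → z k l * z k j))
        ≈⟨ sum-cong-≋ (λ l → trans (*-congˡ (trans (complete-z l j) (δ-sym l j)))
             (*-comm (laplacian G i l) (δ j l))) ⟩
      sum (λ l → δ j l * laplacian G i l)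
        ≈⟨ sum-δ j (laplacian G i) ⟩
      laplacian G i j ∎
      where
      zᵢ zⱼ : Fin n → Carrier
      zᵢ k = z (inject₁ k) i
      zⱼ k = z (inject₁ k) j
      term : Fin (suc n) → Carrier
      term k = μ k * z k i * z k j

    -- With 1 the all-ones vector, μ_k 1ᵀz_k = 1ᵀQz_k = 0, and μ_k is positive.
    sum-z≈0 : ∀ k → sum (z (inject₁ k)) ≈ 0#
    sum-z≈0 k = *-cancel-pos (μ (inject₁ k)) (μ-pos k) (begin
      μ (inject₁ k) * sum y
        ≈⟨ *-distribˡ-sum (μ (inject₁ k)) y ⟩
      sum (λ i → μ (inject₁ k) * y i)
        ≈⟨ sum-cong-≋ (eigen (inject₁ k)) ⟨
      sum (λ i → sum (λ j → laplacian G i j * y j))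
        ≈⟨ ∑-comm (λ i j → laplacian G i j * y j) ⟩
      sum (λ j → sum (λ i → laplacian G i j * y j))
        ≈⟨ sum-zero (λ j → trans (sym (*-distribʳ-sum (y j) (λ i → laplacian G i j)))
             (trans (*-congʳ (laplacian-column G j)) (zeroˡ (y j)))) ⟩
      0# ∎)
      where
      y : Vector Carrier (suc n)
      y = z (inject₁ k)

    sum-s≈0 : ∀ k → sum (λ i → s B i k) ≈ 0#
    sum-s≈0 k = begin
      sum (λ i → z (inject₁ k) i * √μ B k)   ≈⟨ *-distribʳ-sum (√μ B k) (z (inject₁ k)) ⟨
      sum (z (inject₁ k)) * √μ B k           ≈⟨ *-congʳ (sum-z≈0 k) ⟩
      0# * √μ B k                            ≈⟨ zeroˡ _ ⟩
      0#                                     ∎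

    -- Expanding the all-ones vector in the eigenbasis leaves only its zₙ term.
    zₙ*sum≈1 : ∀ i → zₙ i * sum zₙ ≈ 1#
    zₙ*sum≈1 i = begin
      zₙ i * sum zₙ
        ≈⟨ +-identityˡ _ ⟨
      0# + term (fromℕ n)
        ≈⟨ +-congʳ (sum-zero (λ k → trans (*-congˡ (sum-z≈0 k)) (zeroʳ _))) ⟨
      sum (λ k → term (inject₁ k)) + term (fromℕ n)
        ≈⟨ sum-init-last term ⟨
      sum (λ k → z k i * sum (z k))
        ≈⟨ sum-cong-≋ (λ k → *-distribˡ-sum (z k i) (z k)) ⟩
      sum (λ k → sum (λ j → z k i * z k j))
        ≈⟨ ∑-comm (λ k j → z k i * z k j) ⟩
      sum (λ j → sum (λ k → z k i * z k j))
        ≈⟨ sum-cong-≋ (λ j → trans (complete-z i j) (sym (*-identityʳ (δ i j)))) ⟩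
      sum (λ j → δ i j * 1#)
        ≈⟨ sum-δ i (λ _ → 1#) ⟩
      1# ∎
      where
      term : Fin (suc n) → Carrier
      term k = z k i * sum (z k)

    -- Every entry has product 1 with the same number `sum zₙ`, and inverses are unique.
    zₙ-constant : ∀ i j → zₙ i ≈ zₙ j
    zₙ-constant i j = begin
      zₙ i                    ≈⟨ *-identityʳ (zₙ i) ⟨
      zₙ i * 1#               ≈⟨ *-congˡ (zₙ*sum≈1 j) ⟨
      zₙ i * (zₙ j * sum zₙ)  ≈⟨ x∙yz≈y∙xz (zₙ i) (zₙ j) (sum zₙ) ⟩
      zₙ j * (zₙ i * sum zₙ)  ≈⟨ *-congˡ (zₙ*sum≈1 i) ⟩
      zₙ j * 1#               ≈⟨ *-identityʳ (zₙ j) ⟩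
      zₙ j                    ∎

    -- The square roots cancel, leaving the completeness sum without its last term: the projection
    -- orthogonal to `zₙ`.
    s∙s⁺ : ∀ i j → s B i ∙ s⁺ B j ≈ δ i j - zₙ i * zₙ j
    s∙s⁺ i j = begin
      s B i ∙ s⁺ B j
        ≈⟨ sum-cong-≋ (λ k → trans (interchange (z (inject₁ k) i) (√μ B k) (z (inject₁ k) j) _)
             (trans (*-congˡ (trans (*-comm _ _) (⁻¹-inverseˡ _ _))) (*-identityʳ _))) ⟩
      sum (λ k → term (inject₁ k))
        ≈⟨ x+y-y≈x _ (term (fromℕ n)) ⟨
      sum (λ k → term (inject₁ k)) + term (fromℕ n) - term (fromℕ n)
        ≈⟨ +-congʳ (sum-init-last term) ⟨
      sum term - term (fromℕ n)
        ≈⟨ +-congʳ (complete-z i j) ⟩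
      δ i j - zₙ i * zₙ j ∎
      where
      term : Fin (suc n) → Carrier
      term k = z k i * z k j
      x+y-y≈x : ∀ x y → x + y - y ≈ x
      x+y-y≈x x y = trans (+-assoc x y (- y)) (trans (+-congˡ (-‿inverseʳ y)) (+-identityʳ x))

    s⁺-s-resolution : ∀ k l → sum (λ i → s⁺ B i k * s B i l) ≈ δ k l
    s⁺-s-resolution k l = begin
      sum (λ i → s⁺ B i k * s B i l)
        ≈⟨ ∙-* (z (inject₁ k)) (z (inject₁ l)) (√μ B k ⁻¹[ √μ-pos B k ]) (√μ B l) ⟩
      z (inject₁ k) ∙ z (inject₁ l) * (√μ B k ⁻¹[ √μ-pos B k ] * √μ B l)
        ≈⟨ *-congʳ (trans (orthonormal (inject₁ k) (inject₁ l))
             (𝟙-cong (mk⇔ Finₚ.inject₁-injective (≡.cong inject₁)) (inject₁ k ≟ inject₁ l) (k ≟ l))) ⟩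
      δ k l * (√μ B k ⁻¹[ √μ-pos B k ] * √μ B l)
        ≈⟨ cancel (k ≟ l) ⟩
      δ k l ∎
      where
      cancel : (k≟l : Dec (k ≡.≡ l)) →
        𝟙 k≟l * (√μ B k ⁻¹[ √μ-pos B k ] * √μ B l) ≈ 𝟙 k≟l
      cancel (yes ≡.refl) = trans (*-identityˡ _) (⁻¹-inverseˡ _ _)
      cancel (no _)       = zeroˡ _

    -- Dual frames reproduce every vector. The N vertices are dependent in N - 1 dimensions, so a
    -- constant may be added to all coefficients without changing the sum.
    s-expansion : ∀ a k → a k ≈ sum (λ i → (a ∙ s⁺ B i) * s B i k)
    s-expansion a k = begin
      a k
        ≈⟨ sum-δ k a ⟨
      sum (λ l → δ k l * a l)
        ≈⟨ sum-cong-≋ (λ l → trans (*-comm _ _)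
             (*-congˡ (trans (δ-sym k l) (sym (s⁺-s-resolution l k))))) ⟩
      sum (λ l → a l * sum (λ i → s⁺ B i l * s B i k))
        ≈⟨ sum-*-swap a (λ i → s B i k) (λ l i → s⁺ B i l) ⟩
      sum (λ i → (a ∙ s⁺ B i) * s B i k) ∎

    σ : Subset (suc n) → Vector Carrier n
    σ V = combination (χ V) (s B)

    centroid≈ : ∀ V ne k → centroid B V ne k ≈ σ V k * card V ⁻¹[ card-pos ne ]
    centroid≈ V ne k = *-congʳ (sum-cong-≋ (λ i → if≈𝟙* (i ∈? V) (s B i k)))

    σ∙σ : ∀ U V → Empty (U ∩ₛ V) → σ U ∙ σ V ≈ - weight G (between? G U V)
    σ∙σ U V ¬UV = begin
      σ U ∙ σ V
        ≈⟨ ∙-combinationˡ (χ U) (s B) (σ V) ⟩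
      sum (λ i → χ U i * (s B i ∙ σ V))
        ≈⟨ sum-cong-≋ (λ i → *-congˡ {χ U i} (trans (∙-combinationʳ (s B i) (χ V) (s B))
             (sum-cong-≋ (λ j → *-congˡ {χ V j} (s∙s≈laplacian i j))))) ⟩
      sum (λ i → χ U i * sum (λ j → χ V j * laplacian G i j))
        ≈⟨ sum-cong-≋ (λ i → *-distribˡ-sum (χ U i) (λ j → χ V j * laplacian G i j)) ⟩
      sum (λ i → sum (λ j → χ U i * (χ V j * laplacian G i j)))
        ≈⟨ laplacian-between G U V ¬UV ⟩
      - weight G (between? G U V) ∎

    -- The vertices of the original simplex sum to 0.
    σ-∁ : ∀ V k → σ V k ≈ - σ (∁ V) k
    σ-∁ V k = +-inverseˡ-unique _ _ (begin
      σ V k + σ (∁ V) k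
        ≈⟨ ∑-distrib-+ (λ i → χ V i * s B i k) (λ i → χ (∁ V) i * s B i k) ⟨
      sum (λ i → χ V i * s B i k + χ (∁ V) i * s B i k)
        ≈⟨ sum-cong-≋ (λ i → trans (sym (distribʳ (s B i k) (χ V i) (χ (∁ V) i)))
             (trans (*-congʳ (χ-∁ V i)) (*-identityˡ (s B i k)))) ⟩
      sum (λ i → s B i k)
        ≈⟨ sum-s≈0 k ⟩
      0# ∎)

    σ∙σ≈weight-∂ : ∀ V → σ V ∙ σ V ≈ weight G (∂? G V)
    σ∙σ≈weight-∂ V = begin
      σ V ∙ σ V                     ≈⟨ ∙-cong (λ _ → refl) (σ-∁ V) ⟩
      σ V ∙ (λ k → - σ (∁ V) k)     ≈⟨ ∙-negʳ (σ V) (σ (∁ V)) ⟩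
      - (σ V ∙ σ (∁ V))             ≈⟨ -‿cong (σ∙σ V (∁ V) disjoint) ⟩
      - - weight G (∂? G V)         ≈⟨ -‿involutive _ ⟩
      weight G (∂? G V)             ∎
      where
      disjoint : Empty (V ∩ₛ ∁ V)
      disjoint (i , i∈) with i∈V , i∈∁V ← x∈p∩q⁻ V (∁ V) i∈ = x∈p⇒x∉∁p i∈V i∈∁V

    σ∙s⁺ : ∀ V i → σ V ∙ s⁺ B i ≈ χ V i - (χ V ∙ zₙ) * zₙ (fromℕ n)
    σ∙s⁺ V i = begin
      σ V ∙ s⁺ B i
        ≈⟨ ∙-combinationˡ (χ V) (s B) (s⁺ B i) ⟩
      sum (λ j → χ V j * (s B j ∙ s⁺ B i))
        -- The entry of `zₙ` at i is replaced by the one at a fixed index, so that the correction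
        -- term no longer depends on i.
        ≈⟨ sum-cong-≋ (λ j → *-congˡ {χ V j} (trans (s∙s⁺ j i)
             (+-cong (δ-sym j i) (-‿cong (*-congˡ (zₙ-constant i (fromℕ n))))))) ⟩
      χ V ∙ (λ j → δ i j - zₙ j * zₙ (fromℕ n))
        ≈⟨ ∙-minusʳ (χ V) (δ i) (λ j → zₙ j * zₙ (fromℕ n)) ⟩
      χ V ∙ δ i - χ V ∙ (λ j → zₙ j * zₙ (fromℕ n))
        ≈⟨ +-cong (trans (∙-comm (χ V) (δ i)) (sum-δ i (χ V)))
             (-‿cong (∙-*ʳ (χ V) zₙ (zₙ (fromℕ n)))) ⟩
      χ V i - (χ V ∙ zₙ) * zₙ (fromℕ n) ∎

    -- A value shared by the vertices passes to the hull because the weights sum to 1. With v = 1 on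
    -- V and v = 0 on its complement, the two faces lie in parallel hyperplanes normal to `σ V`.
    σ∙face : ∀ V {U p v} → Face⁺ B U p → (∀ {i} → i ∈ U → χ V i ≈ v) →
             σ V ∙ p ≈ v - (χ V ∙ zₙ) * zₙ (fromℕ n)
    σ∙face V {U} {p} {v} (x , _ , x≈0 , ∑x≈1 , p≈) χ≈v = begin
      σ V ∙ p                                     ≈⟨ ∙-cong (λ _ → refl) p≈ ⟩
      σ V ∙ combination x (s⁺ B)                  ≈⟨ ∙-combinationʳ (σ V) x (s⁺ B) ⟩
      sum (λ i → x i * (σ V ∙ s⁺ B i))            ≈⟨ sum-cong-≋ term ⟩
      sum (λ i → x i * (v - κ))                   ≈⟨ *-distribʳ-sum (v - κ) x ⟨
      sum x * (v - κ)                             ≈⟨ *-congʳ ∑x≈1 ⟩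
      1# * (v - κ)                                ≈⟨ *-identityˡ (v - κ) ⟩
      v - κ                                       ∎
      where
      κ : Carrier
      κ = (χ V ∙ zₙ) * zₙ (fromℕ n)
      term : ∀ i → x i * (σ V ∙ s⁺ B i) ≈ x i * (v - κ)
      term i with i ∈? U
      ... | yes i∈U = *-congˡ (trans (σ∙s⁺ V i) (+-congʳ (χ≈v i∈U)))
      ... | no  i∉U = trans (trans (*-congʳ (x≈0 i∉U)) (zeroˡ _))
                        (sym (trans (*-congʳ (x≈0 i∉U)) (zeroˡ _)))

    -- An altitude a has constant inner products α and β with the vertices of the
    -- two faces; expanding a in the dual frame of the sᵢ, whose sum is 0, gives
    -- a = (α - β) σ V.  The scale is fixed by σ V ∙ (p - q) = -1.
    altitude≈ : ∀ {V a} → Nonempty V → V ⊂ ⊤ → IsAltitude⁺ B V a →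
      ∃ λ τ → (∀ k → a k ≈ σ V k * τ) × τ * weight G (∂? G V) ≈ - 1#
    altitude≈ {V} {a} (i₀ , i₀∈V) (_ , j₀ , _ , j₀∉V)
      ((p , q , p∈ , q∈ , a≈p-q) , a⊥V , a⊥∁V) = τ , a≈στ , τ∂≈-1
      where
      α β τ : Carrier
      α = a ∙ s⁺ B i₀
      β = a ∙ s⁺ B j₀
      τ = α - β

      a∙vertices≈ : ∀ {U i j} → OrthogonalTo B a (Face⁺ B U) → i ∈ U → j ∈ U →
                    a ∙ s⁺ B i ≈ a ∙ s⁺ B j
      a∙vertices≈ {i = i} {j} a⊥U i∈U j∈U = x∙y⁻¹≈ε⇒x≈y _ _
        (trans (sym (∙-minusʳ a (s⁺ B i) (s⁺ B j)))
          (a⊥U _ _ (vertex∈hull (s⁺ B) i∈U) (vertex∈hull (s⁺ B) j∈U)))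

      a∙s⁺≈ : ∀ i → a ∙ s⁺ B i ≈ χ V i * τ + β
      a∙s⁺≈ i with i ∈? V
      ... | yes i∈V = begin
        a ∙ s⁺ B i        ≈⟨ a∙vertices≈ a⊥V i∈V i₀∈V ⟩
        α                 ≈⟨ +-identityʳ α ⟨
        α + 0#            ≈⟨ +-congˡ (-‿inverseˡ β) ⟨
        α + (- β + β)     ≈⟨ +-assoc α (- β) β ⟨
        α - β + β         ≈⟨ +-congʳ (*-identityˡ τ) ⟨
        1# * τ + β        ∎
      ... | no  i∉V = begin
        a ∙ s⁺ B i        ≈⟨ a∙vertices≈ a⊥∁V (x∉p⇒x∈∁p i∉V) (x∉p⇒x∈∁p j₀∉V) ⟩
        β                 ≈⟨ +-identityˡ β ⟨
        0# + β            ≈⟨ +-congʳ (zeroˡ τ) ⟨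
        0# * τ + β        ∎

      a≈στ : ∀ k → a k ≈ σ V k * τ
      a≈στ k = begin
        a k
          ≈⟨ s-expansion a k ⟩
        sum (λ i → (a ∙ s⁺ B i) * s B i k)
          ≈⟨ sum-cong-≋ (λ i → trans (*-congʳ (a∙s⁺≈ i))
               (trans (distribʳ (s B i k) (χ V i * τ) β)
                 (+-congʳ (xy∙z≈xz∙y (χ V i) τ (s B i k))))) ⟩
        sum (λ i → χ V i * s B i k * τ + β * s B i k)
          ≈⟨ ∑-distrib-+ (λ i → χ V i * s B i k * τ) (λ i → β * s B i k) ⟩
        sum (λ i → χ V i * s B i k * τ) + sum (λ i → β * s B i k)
          ≈⟨ +-cong (sym (*-distribʳ-sum τ (λ i → χ V i * s B i k)))
               (trans (sym (*-distribˡ-sum β (λ i → s B i k)))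
                 (trans (*-congˡ (sum-s≈0 k)) (zeroʳ β))) ⟩
        σ V k * τ + 0#
          ≈⟨ +-identityʳ _ ⟩
        σ V k * τ ∎

      κ : Carrier
      κ = (χ V ∙ zₙ) * zₙ (fromℕ n)

      τ∂≈-1 : τ * weight G (∂? G V) ≈ - 1#
      τ∂≈-1 = begin
        τ * weight G (∂? G V)         ≈⟨ *-comm τ _ ⟩
        weight G (∂? G V) * τ         ≈⟨ *-congʳ (σ∙σ≈weight-∂ V) ⟨
        σ V ∙ σ V * τ                 ≈⟨ ∙-*ʳ (σ V) (σ V) τ ⟨
        σ V ∙ (λ k → σ V k * τ)       ≈⟨ ∙-cong (λ _ → refl) a≈στ ⟨
        σ V ∙ a                       ≈⟨ ∙-cong (λ _ → refl) a≈p-q ⟩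
        σ V ∙ (p ⊖ q)                 ≈⟨ ∙-minusʳ (σ V) p q ⟩
        σ V ∙ p - σ V ∙ q             ≈⟨ +-cong
          (σ∙face V p∈ (λ {i} i∈∁V → 𝟙-false (i ∈? V) (x∈∁p⇒x∉p i∈∁V)))
          (-‿cong (σ∙face V q∈ (λ {i} i∈V → 𝟙-true (i ∈? V) i∈V))) ⟩
        -- The offset `κ` is common to both hyperplanes and cancels.
        0# - κ - (1# - κ)             ≈⟨ +-cong (+-identityˡ (- κ)) (-‿anti-homo-+ 1# (- κ)) ⟩
        - κ + (- - κ - 1#)            ≈⟨ +-assoc (- κ) (- - κ) (- 1#) ⟨
        - κ - - κ - 1#                ≈⟨ +-congʳ (-‿inverseʳ (- κ)) ⟩
        0# - 1#                       ≈⟨ +-identityˡ (- 1#) ⟩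
        - 1#                          ∎

    inner-centroids : ∀ V₁ V₂ (ne₁ : Nonempty V₁) (ne₂ : Nonempty V₂) →
      Empty (V₁ ∩ₛ V₂) →
      inner (centroid B V₁ ne₁) (centroid B V₂ ne₂) ≈
      - (weight G (∂? G V₁ ∩? ∂? G V₂)
           / (card V₁ * card V₂) [ *-pos (card-pos ne₁) (card-pos ne₂) ])
    inner-centroids V₁ V₂ ne₁ ne₂ ¬V₁V₂ = ∙-scaled _
      (centroid≈ V₁ ne₁) (centroid≈ V₂ ne₂)
      (trans (σ∙σ V₁ V₂ ¬V₁V₂) (-‿cong (sym (weight-∂∩∂ G V₁ V₂ ¬V₁V₂))))
      (trans (interchange _ _ _ _)
        (trans (*-cong (⁻¹-inverseˡ _ _) (⁻¹-inverseˡ _ _)) (*-identityˡ 1#)))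

    inner-altitudes : (conn : Connected G) (V₁ V₂ : Subset (suc n))
      (ne₁ : Nonempty V₁) (V₁⊂⊤ : V₁ ⊂ ⊤) (ne₂ : Nonempty V₂) (V₂⊂⊤ : V₂ ⊂ ⊤) →
      Empty (V₁ ∩ₛ V₂) →
      ∀ a₁ a₂ → IsAltitude⁺ B V₁ a₁ → IsAltitude⁺ B V₂ a₂ →
      inner a₁ a₂ ≈
      - (weight G (∂? G V₁ ∩? ∂? G V₂)
           / (weight G (∂? G V₁) * weight G (∂? G V₂))
               [ *-pos (∂-weight-pos G conn ne₁ V₁⊂⊤)
                       (∂-weight-pos G conn ne₂ V₂⊂⊤) ])
    inner-altitudes conn V₁ V₂ ne₁ V₁⊂⊤ ne₂ V₂⊂⊤ ¬V₁V₂ a₁ a₂ alt₁ alt₂ =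
      let τ₁ , a₁≈ , τ₁∂₁≈-1 = altitude≈ ne₁ V₁⊂⊤ alt₁
          τ₂ , a₂≈ , τ₂∂₂≈-1 = altitude≈ ne₂ V₂⊂⊤ alt₂
      in ∙-scaled _ a₁≈ a₂≈
        (trans (σ∙σ V₁ V₂ ¬V₁V₂) (-‿cong (sym (weight-∂∩∂ G V₁ V₂ ¬V₁V₂))))
        -- Each scale contributes a factor -1; the two cancel, so the sign of the result is that of
        -- the product of the vectors `σ`.
        (trans (interchange τ₁ τ₂ _ _)
          (trans (*-cong τ₁∂₁≈-1 τ₂∂₂≈-1)
            (trans (-1*x≈-x (- 1#)) (-‿involutive 1#))))

mainTheorem5 : ∀ {c ℓ₁ ℓ₂} (ℝ : Reals c ℓ₁ ℓ₂) → let open GraphGeometry ℝ in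
    ∀ {n} → 2 ℕ.≤ suc n →
    (G : WeightedGraph (suc n)) (conn : Connected G) (B : Eigenbasis G)
    (V₁ V₂ : Subset (suc n))
    (V₁≠∅ : Nonempty V₁) (V₁⊂N : V₁ ⊂ ⊤)
    (V₂≠∅ : Nonempty V₂) (V₂⊂N : V₂ ⊂ ⊤) →
    -- implicit in the last identity, which fails for overlapping node sets
    Empty (V₁ ∩ₛ V₂) →
    (inner (centroid B V₁ V₁≠∅) (centroid B V₂ V₂≠∅)
      ≈ - (weight G (∂? G V₁ ∩? ∂? G V₂)
             / (card V₁ * card V₂) [ *-pos (card-pos V₁≠∅) (card-pos V₂≠∅) ]))
    ×
    (∀ a₁ a₂ → IsAltitude⁺ B V₁ a₁ → IsAltitude⁺ B V₂ a₂ →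
      inner a₁ a₂
        ≈ - (weight G (∂? G V₁ ∩? ∂? G V₂)
               / (weight G (∂? G V₁) * weight G (∂? G V₂))
                   [ *-pos (∂-weight-pos G conn V₁≠∅ V₁⊂N)
                           (∂-weight-pos G conn V₂≠∅ V₂⊂N) ]))
    ×
    (∂ G V₁ ∩ ∂ G V₂ ≐ between G V₁ V₂)
mainTheorem5 ℝ _ G conn B V₁ V₂ V₁≠∅ V₁⊂N V₂≠∅ V₂⊂N ¬V₁V₂ =
    inner-centroids B V₁ V₂ V₁≠∅ V₂≠∅ ¬V₁V₂
  , inner-altitudes B conn V₁ V₂ V₁≠∅ V₁⊂N V₂≠∅ V₂⊂N ¬V₁V₂
  , ∂∩∂≐between G V₁ V₂ ¬V₁V₂
  where
  open SimplexGeometry ℝ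
  open LaplacianCuts ℝ
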